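{- Let $\mathbb K$ be a field of characteristic $p>2$, $r,n\ge1$, and let $\phi_l,\psi_m:\mathbb Z^r\times\mathbb Z^n\to\mathbb K^\times$ ($l=1,\dots,r$, $m=1,\dots,n$) define a $p$-invariant discrete flat connection on the trivial line bundle $\mathbb Z^{r+n}\times\mathbb K\to\mathbb Z^{r+n}$. Then the scalar $p$-curvature functions $$\tilde\phi_l(j,k)=\prod_{i=0}^{p-1}\phi_l(j+ie_l,k),\qquad\tilde\psi_m(j,k)=\prod_{i=0}^{p-1}\psi_m(j,k+if_m)$$ are constant, that is, independent of $(j,k)\in\mathbb Z^r\times\mathbb Z^n$.
   Context: $e_1,\dots,e_r$ and $f_1,\dots,f_n$ are the standard bases of $\mathbb Z^r$ and $\mathbb Z^n$. The functions $(\phi_l,\psi_m)$ define a $p$-invariant discrete flat connection if they are $p$-periodic (invariant under shifts by $pe_i$ and $pf_i$) and satisfy, for all indices and all $(j,k)$: $\phi_l(j+e_i,k)\phi_i(j,k)=\phi_i(j+e_l,k)\phi_l(j,k)$, $\psi_m(j,k+f_i)\psi_i(j,k)=\psi_i(j,k+f_m)\psi_m(j,k)$, and $\psi_m(j+e_i,k)\phi_i(j,k)=\phi_i(j,k+f_m)\psi_m(j,k)$. -}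

module Defs where

open import Level using (Level; _⊔_)
open import Algebra.Bundles using (CommutativeRing)
open import Algebra.Apartness.Bundles using (HeytingField; HeytingCommutativeRing)
import Algebra.Definitions.RawMonoid as RawMonoidDefinitions
open import Data.Fin.Base using (Fin; toℕ)
open import Data.Integer.Base as ℤ using (ℤ; +_; 0ℤ; 1ℤ)
open import Data.Nat.Base using (ℕ)
open import Data.Nat.Divisibility using (_∣_)
open import Data.Product.Base using (∃-syntax; proj₁)
open import Data.Vec.Base using (Vec; replicate; zipWith; map; _[_]≔_)
open import Function.Bundles using (_⇔_)

infixl 6 _+ᵛ_
infixl 7 _·ᵛ_

-- First-order vectors, so that propositional equality on ℤ^ d is
-- componentwise without function extensionality.
ℤ^_ : ℕ → Set
ℤ^ d = Vec ℤ d

_+ᵛ_ : ∀ {d : ℕ} → ℤ^ d → ℤ^ d → ℤ^ d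
_+ᵛ_ = zipWith ℤ._+_

_·ᵛ_ : ∀ {d : ℕ} → ℕ → ℤ^ d → ℤ^ d
c ·ᵛ v = map (+ c ℤ.*_) v

basis : ∀ {d : ℕ} → Fin d → ℤ^ d
basis {d} i = replicate d 0ℤ [ i ]≔ 1ℤ

-- A Heyting field is the constructive notion of field: classically, with
-- x # y read as x ≉ y, it is exactly a field. Nontriviality is implied, since
-- invertibility of 0# would give 0# # 0#.
module OverField {c ℓ₁ ℓ₂ : Level} (K : HeytingField c ℓ₁ ℓ₂) where

  open HeytingField K using (Carrier; _≈_; _#_; _*_; 0#; 1#)

  private
    ring : CommutativeRing c ℓ₁
    ring = HeytingCommutativeRing.commutativeRing (HeytingField.heytingCommutativeRing K)

  open RawMonoidDefinitions (CommutativeRing.+-rawMonoid ring) using (_×_)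
  open RawMonoidDefinitions (CommutativeRing.*-rawMonoid ring) using () renaming (sum to product)

  -- The kernel of ℤ → K is generated by p.
  HasCharacteristic : ℕ → Set ℓ₁
  HasCharacteristic p = ∀ (m : ℕ) → (m × 1# ≈ 0#) ⇔ (p ∣ m)

  K× : Set (c ⊔ ℓ₂)
  K× = ∃[ x ] x # 0#

  module _ {r n : ℕ} (p : ℕ)
           (φ : Fin r → ℤ^ r → ℤ^ n → K×)
           (ψ : Fin n → ℤ^ r → ℤ^ n → K×) where

    private
      φ′ : Fin r → ℤ^ r → ℤ^ n → Carrier
      φ′ l j k = proj₁ (φ l j k)

      ψ′ : Fin n → ℤ^ r → ℤ^ n → Carrier
      ψ′ m j k = proj₁ (ψ m j k)

      e : Fin r → ℤ^ r
      e = basis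

      f : Fin n → ℤ^ n
      f = basis

    record IsInvariantDiscreteFlatConnection : Set ℓ₁ where
      field
        φ-periodic-e : ∀ l i j k → φ′ l (j +ᵛ p ·ᵛ e i) k ≈ φ′ l j k
        φ-periodic-f : ∀ l i j k → φ′ l j (k +ᵛ p ·ᵛ f i) ≈ φ′ l j k
        ψ-periodic-e : ∀ m i j k → ψ′ m (j +ᵛ p ·ᵛ e i) k ≈ ψ′ m j k
        ψ-periodic-f : ∀ m i j k → ψ′ m j (k +ᵛ p ·ᵛ f i) ≈ ψ′ m j k
        flat-φφ : ∀ l i j k →
          φ′ l (j +ᵛ e i) k * φ′ i j k ≈ φ′ i (j +ᵛ e l) k * φ′ l j k
        flat-ψψ : ∀ m i j k →
          ψ′ m j (k +ᵛ f i) * ψ′ i j k ≈ ψ′ i j (k +ᵛ f m) * ψ′ m j k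
        flat-ψφ : ∀ m i j k →
          ψ′ m (j +ᵛ e i) k * φ′ i j k ≈ φ′ i j (k +ᵛ f m) * ψ′ m j k

    φ-curvature : Fin r → ℤ^ r → ℤ^ n → Carrier
    φ-curvature l j k = product {p} (λ i → φ′ l (j +ᵛ toℕ i ·ᵛ e l) k)

    ψ-curvature : Fin n → ℤ^ r → ℤ^ n → Carrier
    ψ-curvature m j k = product {p} (λ i → ψ′ m j (k +ᵛ toℕ i ·ᵛ f m))

  IsConstant : ∀ {r n : ℕ} → (ℤ^ r → ℤ^ n → Carrier) → Set ℓ₁
  IsConstant g = ∀ j k j′ k′ → g j k ≈ g j′ k′

{-# OPTIONS --safe #-}

-- Flatness says that moving a line of edges in direction l by one lattice step
-- conjugates each edge factor by the transverse function T at its two ends: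
-- G(x) T(x) = T(x + e_l) F(x).  Over p consecutive edges the product telescopes
-- to (Π G) T(x) = T(x + p e_l) (Π F), and periodicity lets the invertible T cancel.
-- Hence each curvature is invariant under all unit steps of the lattice.

module Submission where

open import Defs
open import Level using (Level)
open import Algebra.Apartness.Bundles using (HeytingField)
open import Data.Fin.Base using (Fin)
open import Data.Nat.Base using (ℕ; _<_; _≤_)
open import Data.Product.Base using (_×_)

open import Algebra.Apartness.Bundles using (HeytingCommutativeRing)
open import Algebra.Bundles using (CommutativeRing; CommutativeMonoid)
import Algebra.Apartness.Properties.HeytingCommutativeRing as HeytingCommutativeRingProperties
import Algebra.Definitions.RawMonoid as RawMonoidDefinitions
import Algebra.Properties.CommutativeSemigroup as CommutativeSemigroupProperties
import Algebra.Properties.Monoid.Sum as MonoidSum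
open import Data.Fin.Base using (zero; suc; toℕ)
open import Data.Integer.Base as ℤ using (ℤ; +_; -[1+_]; 0ℤ; 1ℤ)
import Data.Integer.Properties as ℤ
import Data.Nat.Properties as ℕ
open import Data.Nat.Base using (zero; suc)
open import Data.Product.Base using (_,_; proj₁; proj₂)
open import Data.Vec.Base using ([]; _∷_; replicate)
import Data.Vec.Properties as Vec
open import Function.Base using (_∘_)
open import Relation.Binary.Bundles using (Setoid)
open import Relation.Binary.PropositionalEquality using (_≡_; refl; sym; trans; cong; cong₂; module ≡-Reasoning)
import Relation.Binary.Reasoning.Setoid as ≈-Reasoning

+ᵛ-identityʳ : ∀ {d} (v : ℤ^ d) → v +ᵛ replicate d 0ℤ ≡ v
+ᵛ-identityʳ = Vec.zipWith-identityʳ ℤ.+-identityʳ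

+ᵛ-assoc : ∀ {d} (u v w : ℤ^ d) → (u +ᵛ v) +ᵛ w ≡ u +ᵛ (v +ᵛ w)
+ᵛ-assoc = Vec.zipWith-assoc ℤ.+-assoc

+ᵛ-comm : ∀ {d} (u v : ℤ^ d) → u +ᵛ v ≡ v +ᵛ u
+ᵛ-comm = Vec.zipWith-comm ℤ.+-comm

+ᵛ-right-comm : ∀ {d} (u v w : ℤ^ d) → (u +ᵛ v) +ᵛ w ≡ (u +ᵛ w) +ᵛ v
+ᵛ-right-comm u v w = begin
  (u +ᵛ v) +ᵛ w ≡⟨ +ᵛ-assoc u v w ⟩
  u +ᵛ (v +ᵛ w) ≡⟨ cong (u +ᵛ_) (+ᵛ-comm v w) ⟩
  u +ᵛ (w +ᵛ v) ≡⟨ +ᵛ-assoc u w v ⟨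
  (u +ᵛ w) +ᵛ v ∎
  where open ≡-Reasoning

·ᵛ-zeroˡ : ∀ {d} (v : ℤ^ d) → 0 ·ᵛ v ≡ replicate d 0ℤ
·ᵛ-zeroˡ []      = refl
·ᵛ-zeroˡ (x ∷ v) = cong₂ _∷_ (ℤ.*-zeroˡ x) (·ᵛ-zeroˡ v)

·ᵛ-suc : ∀ {d} c (v : ℤ^ d) → suc c ·ᵛ v ≡ v +ᵛ c ·ᵛ v
·ᵛ-suc c []      = refl
·ᵛ-suc c (x ∷ v) = cong₂ _∷_ (ℤ.suc-* (+ c) x) (·ᵛ-suc c v)

+ᵛ-0·ᵛ : ∀ {d} (u v : ℤ^ d) → u +ᵛ 0 ·ᵛ v ≡ u
+ᵛ-0·ᵛ u v = trans (cong (u +ᵛ_) (·ᵛ-zeroˡ v)) (+ᵛ-identityʳ u)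

-- The last step is split off on the right, so that consecutive points of a line differ by `+ᵛ v`,
-- the form in which flatness is stated.
+ᵛ-suc·ᵛ : ∀ {d} c (u v : ℤ^ d) → u +ᵛ suc c ·ᵛ v ≡ (u +ᵛ c ·ᵛ v) +ᵛ v
+ᵛ-suc·ᵛ c u v = begin
  u +ᵛ suc c ·ᵛ v    ≡⟨ cong (u +ᵛ_) (·ᵛ-suc c v) ⟩
  u +ᵛ (v +ᵛ c ·ᵛ v) ≡⟨ +ᵛ-assoc u v (c ·ᵛ v) ⟨
  (u +ᵛ v) +ᵛ c ·ᵛ v ≡⟨ +ᵛ-right-comm u v (c ·ᵛ v) ⟩
  (u +ᵛ c ·ᵛ v) +ᵛ v ∎
  where open ≡-Reasoning

module _ {c ℓ} (S : Setoid c ℓ) where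

  open Setoid S using (Carrier; _≈_; reflexive) renaming (refl to ≈-refl; sym to ≈-sym; trans to ≈-trans)

  ℤ-shift-invariant⇒constant : (h : ℤ → Carrier) → (∀ x → h (x ℤ.+ 1ℤ) ≈ h x) →
                               ∀ x y → h x ≈ h y
  ℤ-shift-invariant⇒constant h inv x y = ≈-trans (h≈h0 x) (≈-sym (h≈h0 y))
    where
    h≈h0 : ∀ x → h x ≈ h 0ℤ
    h≈h0 (+ zero)      = ≈-refl
    -- `+ n ℤ.+ 1ℤ` computes to `+ (n + 1)`, hence the commutation. In the negative cases adding
    -- `1ℤ` computes directly to the next integer towards `0ℤ`.
    h≈h0 (+ suc n)     = ≈-trans (reflexive (cong (h ∘ +_) (ℕ.+-comm 1 n))) (≈-trans (inv (+ n)) (h≈h0 (+ n)))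
    h≈h0 -[1+ zero ]   = ≈-sym (inv -[1+ zero ])
    h≈h0 -[1+ suc n ]  = ≈-trans (≈-sym (inv -[1+ suc n ])) (h≈h0 -[1+ n ])

  -- Induction on the dimension: first move the head coordinate from `x` to `y`, then treat the tail
  -- with the head frozen at `y`.
  shift-invariant⇒constant : ∀ {d} (g : ℤ^ d → Carrier) → (∀ i v → g (v +ᵛ basis i) ≈ g v) →
                             ∀ v w → g v ≈ g w
  shift-invariant⇒constant g inv []      []      = ≈-refl
  shift-invariant⇒constant g inv (x ∷ v) (y ∷ w) = ≈-trans
    (ℤ-shift-invariant⇒constant (λ z → g (z ∷ v)) invˡ x y)
    (shift-invariant⇒constant (λ u → g (y ∷ u)) invʳ v w)
    where
    invˡ : ∀ z → g ((z ℤ.+ 1ℤ) ∷ v) ≈ g (z ∷ v)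
    -- `basis zero` has tail zero and `basis (suc i)` has head zero; adding these zeros is the
    -- identity only propositionally, so both shifts need a transport.
    invˡ z = ≈-trans (reflexive (cong (λ u → g ((z ℤ.+ 1ℤ) ∷ u)) (sym (+ᵛ-identityʳ v)))) (inv zero (z ∷ v))

    invʳ : ∀ i u → g (y ∷ (u +ᵛ basis i)) ≈ g (y ∷ u)
    invʳ i u = ≈-trans (reflexive (cong (λ z → g (z ∷ (u +ᵛ basis i))) (sym (ℤ.+-identityʳ y)))) (inv (suc i) (y ∷ u))

module _ {c ℓ} (M : CommutativeMonoid c ℓ) where

  open CommutativeMonoid M using (Carrier; _≈_; _∙_; ε; ∙-congˡ; ∙-congʳ; comm; assoc; setoid; rawMonoid; commutativeSemigroup)
  open RawMonoidDefinitions rawMonoid using (sum)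
  open CommutativeSemigroupProperties commutativeSemigroup using (xy∙z≈y∙xz; x∙yz≈xz∙y)

  -- Each factor `b i` carries `t i` to `t (suc i)` and turns into `a i`, so only the two end values
  -- of `t` survive. In the multiplicative monoid of the field, `sum` is a product.
  sum-telescope : (a b t : ℕ → Carrier) → (∀ i → b i ∙ t i ≈ t (suc i) ∙ a i) →
                  ∀ n → sum {n} (b ∘ toℕ) ∙ t 0 ≈ t n ∙ sum {n} (a ∘ toℕ)
  sum-telescope a b t step zero    = comm ε (t 0)
  sum-telescope a b t step (suc n) = begin
    (b 0 ∙ B) ∙ t 0         ≈⟨ xy∙z≈y∙xz (b 0) B (t 0) ⟩
    B ∙ (b 0 ∙ t 0)         ≈⟨ ∙-congˡ (step 0) ⟩
    B ∙ (t 1 ∙ a 0)         ≈⟨ assoc B (t 1) (a 0) ⟨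
    -- The induction hypothesis applies to the sequences shifted by one, which run from `t 1` to
    -- `t (suc n)`.
    (B ∙ t 1) ∙ a 0         ≈⟨ ∙-congʳ (sum-telescope (a ∘ suc) (b ∘ suc) (t ∘ suc) (step ∘ suc) n) ⟩
    (t (suc n) ∙ A) ∙ a 0   ≈⟨ x∙yz≈xz∙y (t (suc n)) (a 0) A ⟨
    t (suc n) ∙ (a 0 ∙ A)   ∎
    where
    open ≈-Reasoning setoid
    A B : Carrier
    A = sum {n} (a ∘ suc ∘ toℕ)
    B = sum {n} (b ∘ suc ∘ toℕ)

module _ {c ℓ₁ ℓ₂ : Level} (K : HeytingField c ℓ₁ ℓ₂) where

  open HeytingField K using (Carrier; _≈_; _#_; _*_; 0#; 1#; #⇒invertible)
  open HeytingCommutativeRing (HeytingField.heytingCommutativeRing K) using (commutativeRing)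
  open CommutativeRing commutativeRing using (setoid; reflexive; *-congˡ; *-congʳ; *-identityʳ; *-comm; *-assoc; *-rawMonoid; *-monoid; *-commutativeMonoid)
    renaming (trans to ≈-trans; sym to ≈-sym)
  open RawMonoidDefinitions *-rawMonoid using () renaming (sum to product)
  open MonoidSum *-monoid using () renaming (sum-cong-≗ to product-cong-≗)
  open HeytingCommutativeRingProperties (HeytingField.heytingCommutativeRing K) using (x-0≈x)
  open OverField K

  *-cancelʳ-# : ∀ {x y z} → z # 0# → x * z ≈ y * z → x ≈ y
  *-cancelʳ-# {x} {y} {z} z#0 xz≈yz with #⇒invertible z#0
  ... | w , _ , [z-0]w≈1 = ≈-trans (≈-sym (unit x)) (≈-trans (*-congʳ xz≈yz) (unit y))
    where
    open ≈-Reasoning setoid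
    unit : ∀ u → (u * z) * w ≈ u
    unit u = begin
      (u * z) * w ≈⟨ *-assoc u z w ⟩
      -- Apartness from `0#` provides an inverse of the difference `z - 0#`, which is then replaced
      -- by `z`.
      u * (z * w) ≈⟨ *-congˡ (≈-trans (*-congʳ (≈-sym (x-0≈x z))) [z-0]w≈1) ⟩
      u * 1#      ≈⟨ *-identityʳ u ⟩
      u           ∎

  -- One form for all four curvature shifts: `F` holds the edge factors, `G` the translated ones,
  -- and `T` the connection coefficient in the direction of the translation.
  line-product-invariant : ∀ {d} p (e : ℤ^ d) (F G T : ℤ^ d → Carrier) →
    (∀ x → G x * T x ≈ T (x +ᵛ e) * F x) →
    (∀ x → T (x +ᵛ p ·ᵛ e) ≈ T x) →
    (∀ x → T x # 0#) →
    ∀ x → product {p} (λ i → G (x +ᵛ toℕ i ·ᵛ e)) ≈ product {p} (λ i → F (x +ᵛ toℕ i ·ᵛ e))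
  -- The cancelled factor is `T (pt 0)`, where `pt 0` equals `x` only propositionally; periodicity
  -- is transported accordingly.
  line-product-invariant p e F G T flat periodic T#0 x = *-cancelʳ-# (T#0 (pt 0)) (begin
    ΠG * T (pt 0) ≈⟨ sum-telescope *-commutativeMonoid (F ∘ pt) (G ∘ pt) (T ∘ pt) step p ⟩
    T (pt p) * ΠF ≈⟨ *-congʳ (≈-trans (periodic x) (reflexive (cong T (sym (+ᵛ-0·ᵛ x e))))) ⟩
    T (pt 0) * ΠF ≈⟨ *-comm (T (pt 0)) ΠF ⟩
    ΠF * T (pt 0) ∎)
    where
    open ≈-Reasoning setoid
    pt : ℕ → ℤ^ _
    pt i = x +ᵛ i ·ᵛ e

    ΠF ΠG : Carrier
    ΠF = product {p} (λ i → F (pt (toℕ i)))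
    ΠG = product {p} (λ i → G (pt (toℕ i)))

    step : ∀ i → G (pt i) * T (pt i) ≈ T (pt (suc i)) * F (pt i)
    step i = ≈-trans (flat (pt i)) (*-congʳ (reflexive (cong T (sym (+ᵛ-suc·ᵛ i x e)))))

  -- When the shift `s` lies in the same lattice factor as `e`, this puts the shifted product into
  -- the shape `G x = F (x +ᵛ s)`.
  line-product-translate : ∀ {d} p (e s : ℤ^ d) (F : ℤ^ d → Carrier) x →
    product {p} (λ i → F ((x +ᵛ s) +ᵛ toℕ i ·ᵛ e)) ≈ product {p} (λ i → F ((x +ᵛ toℕ i ·ᵛ e) +ᵛ s))
  line-product-translate p e s F x =
    reflexive (product-cong-≗ {p} (λ i → cong F (+ᵛ-right-comm x s (toℕ i ·ᵛ e))))

  module _ {r n : ℕ} (p : ℕ) (φ : Fin r → ℤ^ r → ℤ^ n → K×) (ψ : Fin n → ℤ^ r → ℤ^ n → K×)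
           (connection : IsInvariantDiscreteFlatConnection p φ ψ) where

    open IsInvariantDiscreteFlatConnection connection

    private
      φ′ : Fin r → ℤ^ r → ℤ^ n → Carrier
      φ′ l j k = proj₁ (φ l j k)

      ψ′ : Fin n → ℤ^ r → ℤ^ n → Carrier
      ψ′ m j k = proj₁ (ψ m j k)

    φ-curvature-shift-e : ∀ l k i j → φ-curvature p φ ψ l (j +ᵛ basis i) k ≈ φ-curvature p φ ψ l j k
    φ-curvature-shift-e l k i j = ≈-trans
      (line-product-translate p (basis l) (basis i) (λ x → φ′ l x k) j)
      (line-product-invariant p (basis l) (λ x → φ′ l x k) (λ x → φ′ l (x +ᵛ basis i) k) (λ x → φ′ i x k)
        (λ x → flat-φφ l i x k) (λ x → φ-periodic-e i l x k) (λ x → proj₂ (φ i x k)) j)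

    φ-curvature-shift-f : ∀ l j m k → φ-curvature p φ ψ l j (k +ᵛ basis m) ≈ φ-curvature p φ ψ l j k
    φ-curvature-shift-f l j m k =
      line-product-invariant p (basis l) (λ x → φ′ l x k) (λ x → φ′ l x (k +ᵛ basis m)) (λ x → ψ′ m x k)
        -- The mixed relation is read backwards here, with `ψ′ m` transverse; for the shift of the
        -- ψ-curvature along `e` it is read forwards, with `φ′ i` transverse.
        (λ x → ≈-sym (flat-ψφ m l x k)) (λ x → ψ-periodic-e m l x k) (λ x → proj₂ (ψ m x k)) j

    ψ-curvature-shift-e : ∀ m k i j → ψ-curvature p φ ψ m (j +ᵛ basis i) k ≈ ψ-curvature p φ ψ m j k
    ψ-curvature-shift-e m k i j =
      line-product-invariant p (basis m) (λ y → ψ′ m j y) (λ y → ψ′ m (j +ᵛ basis i) y) (λ y → φ′ i j y)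
        (λ y → flat-ψφ m i j y) (λ y → φ-periodic-f i m j y) (λ y → proj₂ (φ i j y)) k

    ψ-curvature-shift-f : ∀ m j i k → ψ-curvature p φ ψ m j (k +ᵛ basis i) ≈ ψ-curvature p φ ψ m j k
    ψ-curvature-shift-f m j i k = ≈-trans
      (line-product-translate p (basis m) (basis i) (λ y → ψ′ m j y) k)
      (line-product-invariant p (basis m) (λ y → ψ′ m j y) (λ y → ψ′ m j (y +ᵛ basis i)) (λ y → ψ′ i j y)
        (λ y → flat-ψψ m i j y) (λ y → ψ-periodic-f i m j y) (λ y → proj₂ (ψ i j y)) k)

  shift-invariant⇒IsConstant : ∀ {r n} (g : ℤ^ r → ℤ^ n → Carrier) →
    (∀ k i j → g (j +ᵛ basis i) k ≈ g j k) →
    (∀ j i k → g j (k +ᵛ basis i) ≈ g j k) →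
    IsConstant g
  -- The path goes through the corner `(j′, k)`.
  shift-invariant⇒IsConstant g inv-e inv-f j k j′ k′ = ≈-trans
    (shift-invariant⇒constant setoid (λ x → g x k) (inv-e k) j j′)
    (shift-invariant⇒constant setoid (g j′) (inv-f j′) k k′)

lemma3p1 : ∀ {c ℓ₁ ℓ₂ : Level} (K : HeytingField c ℓ₁ ℓ₂) →
    let open OverField K in
    (p : ℕ) → HasCharacteristic p → 2 < p →
    (r n : ℕ) → 1 ≤ r → 1 ≤ n →
    (φ : Fin r → ℤ^ r → ℤ^ n → K×) (ψ : Fin n → ℤ^ r → ℤ^ n → K×) →
    IsInvariantDiscreteFlatConnection p φ ψ →
    ((l : Fin r) → IsConstant (φ-curvature p φ ψ l)) ×
    ((m : Fin n) → IsConstant (ψ-curvature p φ ψ m))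
lemma3p1 K p _ _ r n _ _ φ ψ connection =
  (λ l → shift-invariant⇒IsConstant K _
    (φ-curvature-shift-e K p φ ψ connection l) (φ-curvature-shift-f K p φ ψ connection l)) ,
  (λ m → shift-invariant⇒IsConstant K _
    (ψ-curvature-shift-e K p φ ψ connection m) (ψ-curvature-shift-f K p φ ψ connection m))
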